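{- For any integers $k\geq 1$ and $m\geq 2$, the graph $C_{4k}\times P_m$ admits a $(2m-1)$-divisible graceful $\alpha$-labeling.
   Context: $C_n$ ($n\ge 3$) is the cycle on $n$ vertices and $P_m$ ($m\ge 2$) is the path on $m$ vertices. $C_n\times P_m$ denotes their Cartesian product (the grid on a cylinder): its vertices are the pairs $(i,j)$ with $1\le i\le m$, $1\le j\le n$, and its edges are $[(i,j),(i,j+1)]$ (with $j$ taken modulo $n$) for $1\le i\le m$, and $[(i,j),(i+1,j)]$ for $1\le i\le m-1$. The graph $C_{4k}\times P_m$ is bipartite and has $4k(2m-1)$ edges. The size of a graph is its number of edges. Let $\Gamma$ be a graph of size $e=d\cdot q$ with $d,q$ positive integers. A $d$-divisible graceful labeling of $\Gamma$ is an injective function $f:V(\Gamma)\to\{0,1,2,\ldots,d(q+1)-1\}$ such that $$\{|f(x)-f(y)| : [x,y]\in E(\Gamma)\}=\{1,2,3,\ldots,d(q+1)\}\setminus\{q+1,2(q+1),\ldots,d(q+1)\}.$$ If $\Gamma$ is bipartite, a $d$-divisible graceful $\alpha$-labeling of $\Gamma$ is a $d$-divisible graceful labeling $f$ of $\Gamma$ such that the maximum value of $f$ on one of the two bipartite sets is strictly less than its minimum value on the other one. -}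

module Defs where

open import Data.Bool.Base using (Bool; not)
open import Data.Fin.Base using (Fin; toℕ)
open import Data.Fin.Properties using (*↔×)
open import Data.Nat.Base using (ℕ; suc; _+_; _*_; _≤_; _<_; ∣_-_∣; s≤s; z≤n)
open import Data.Nat.Properties using (1+n≢n; *-monoʳ-≤; ≤-trans; m≤n+m)
open import Data.Product.Base using (Σ-syntax; ∃-syntax; _×_; _,_; proj₁)
open import Data.Product.Function.NonDependent.Propositional using (_×-↔_)
open import Data.Sum.Base using (_⊎_; inj₁; inj₂; swap)
open import Function.Base using (_on_)
open import Function.Bundles using (Bijection; _↔_)
open import Function.Construct.Composition using (_↔-∘_)
open import Function.Construct.Identity using (↔-id)
open import Function.Construct.Symmetry using (↔-sym)
open import Function.Definitions using (Injective)
open import Level using (0ℓ)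
open import Relation.Binary.Bundles using (Setoid)
open import Relation.Binary.Core using (Rel)
open import Relation.Binary.Definitions using (Irreflexive; Symmetric)
open import Relation.Binary.PropositionalEquality
  using (_≡_; _≢_; refl; sym; trans; cong; setoid)
open import Relation.Nullary.Negation using (¬_)
open import Relation.Unary using (Pred; _≐_; _∖_)

record Graph : Set₁ where
  field
    V      : Set
    order  : ℕ
    finite : V ↔ Fin order
    Adj    : Rel V 0ℓ
    symm   : Symmetric Adj
    irrefl : Irreflexive _≡_ Adj

open Graph public using (V; Adj)

data _∼_ {A : Set} : Rel (A × A) 0ℓ where
  same : ∀ {x y} → (x , y) ∼ (x , y)
  flip : ∀ {x y} → (x , y) ∼ (y , x)

∼-sym : ∀ {A} → Symmetric (_∼_ {A})
∼-sym same = same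
∼-sym flip = flip

∼-trans : ∀ {A} {p q r : A × A} → p ∼ q → q ∼ r → p ∼ r
∼-trans same e    = e
∼-trans flip same = flip
∼-trans flip flip = same

-- An edge is an adjacent pair; the setoid equality forgets both the
-- orientation and the adjacency proof, so its classes are the
-- unordered edges [x,y].
edges : Graph → Setoid 0ℓ 0ℓ
edges Γ = record
  { Carrier       = Σ[ (x , y) ∈ V Γ × V Γ ] Adj Γ x y
  ; _≈_           = _∼_ on proj₁
  ; isEquivalence = record { refl = same ; sym = ∼-sym ; trans = ∼-trans }
  }

HasSize : Graph → ℕ → Set
HasSize Γ e = Bijection (setoid (Fin e)) (edges Γ)

path : ℕ → Graph
path m = record
  { V      = Fin m
  ; order  = m
  ; finite = ↔-id (Fin m)
  ; Adj    = λ i j → i ⟶ j ⊎ j ⟶ i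
  ; symm   = swap
  ; irrefl = λ { refl (inj₁ e) → 1+n≢n (sym e) ; refl (inj₂ e) → 1+n≢n (sym e) }
  }
  where
  _⟶_ : Rel (Fin m) 0ℓ
  i ⟶ j = toℕ j ≡ suc (toℕ i)

-- j = i + 1 modulo n, with vertices numbered from 0.
CyclicSuc : ∀ n → Rel (Fin n) 0ℓ
CyclicSuc n i j = toℕ j ≡ suc (toℕ i) ⊎ (suc (toℕ i) ≡ n × toℕ j ≡ 0)

cycle : ∀ n → 3 ≤ n → Graph
cycle n 3≤n = record
  { V      = Fin n
  ; order  = n
  ; finite = ↔-id (Fin n)
  ; Adj    = λ i j → CyclicSuc n i j ⊎ CyclicSuc n j i
  ; symm   = swap
  ; irrefl = λ { refl (inj₁ e) → loopless e ; refl (inj₂ e) → loopless e }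
  }
  where
  1≢n : ∀ {n} → 3 ≤ n → 1 ≢ n
  1≢n (s≤s ()) refl

  loopless : ∀ {i} → ¬ CyclicSuc n i i
  loopless (inj₁ e)       = 1+n≢n (sym e)
  loopless (inj₂ (e , z)) = 1≢n 3≤n (trans (cong suc (sym z)) e)

infixr 7 _□_

_□_ : Graph → Graph → Graph
Γ □ Δ = record
  { V      = V Γ × V Δ
  ; order  = Γ.order * Δ.order
  ; finite = ↔-sym *↔× ↔-∘ (Γ.finite ×-↔ Δ.finite)
  ; Adj    = λ (x , y) (x′ , y′) → (Adj Γ x x′ × y ≡ y′) ⊎ (x ≡ x′ × Adj Δ y y′)
  ; symm   = λ { (inj₁ (a , e)) → inj₁ (Γ.symm a , sym e)
               ; (inj₂ (e , a)) → inj₂ (sym e , Δ.symm a) }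
  ; irrefl = λ { refl (inj₁ (a , _)) → Γ.irrefl refl a
               ; refl (inj₂ (_ , a)) → Δ.irrefl refl a }
  }
  where
  module Γ = Graph Γ
  module Δ = Graph Δ

[1⋯_] : ℕ → Pred ℕ 0ℓ
[1⋯ n ] t = 1 ≤ t × t ≤ n

multiples : ℕ → ℕ → Pred ℕ 0ℓ
multiples d c t = ∃[ i ] [1⋯ d ] i × t ≡ i * c

differences : (Γ : Graph) → (V Γ → ℕ) → Pred ℕ 0ℓ
differences Γ f t = ∃[ x ] ∃[ y ] Adj Γ x y × t ≡ ∣ f x - f y ∣

record DivisibleGracefulLabeling (d : ℕ) (Γ : Graph) : Set where
  field
    -- Determined by `size`, as d > 0.
    q         : ℕ
    d>0       : 0 < d
    q>0       : 0 < q
    size      : HasSize Γ (d * q)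
    f         : V Γ → ℕ
    bounded   : ∀ x → f x < d * (q + 1)
    injective : Injective _≡_ _≡_ f
    graceful  : differences Γ f ≐ [1⋯ d * (q + 1) ] ∖ multiples d (q + 1)

record Bipartition (Γ : Graph) : Set where
  field
    side   : V Γ → Bool
    proper : ∀ {x y} → Adj Γ x y → side x ≢ side y

record DivisibleGracefulAlphaLabeling (d : ℕ) (Γ : Graph) : Set where
  field
    labeling    : DivisibleGracefulLabeling d Γ
    bipartition : Bipartition Γ

  open DivisibleGracefulLabeling labeling public
  open Bipartition bipartition public

  -- Both sides are nonempty, since Γ has d * q > 0 edges; so `separated`
  -- says that the maximum of f on the side `low` is strictly less than
  -- its minimum on the other side.
  field
    low       : Bool
    separated : ∀ {x y} → side x ≡ low → side y ≡ not low → f x < f y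

3≤4* : ∀ {k} → 1 ≤ k → 3 ≤ 4 * k
3≤4* 1≤k = ≤-trans (m≤n+m 3 1) (*-monoʳ-≤ 4 1≤k)

{-# OPTIONS --safe #-}

-- Put n = 4k, c = n + 1 and d = 2m − 1.  The vertex in column p of layer i
-- (both counted from 0) is low when p + i is even, and gets the label
--   ⌊p/2⌋ + i c            if it is low,
--   d c − 1 − h(p) − i c   otherwise,
-- where h(0) = 2k and h(1), h(2), … is 0, 0, 1, 1, 2, 2, … with the value k
-- omitted.  An edge with low end (p , i) and high end (p′ , i′) then has
-- difference d c − 1 − (⌊p/2⌋ + h(p′)) − (i + i′) c.  So each sum i + i′ = s
-- accounts for one block of the required differences, s = 2i being the i-th
-- cycle and s = 2i + 1 the rungs from layer i to layer i + 1.
-- The offset ⌊p/2⌋ + h(p) of a rung is a bijection from columns to {0,…,n−1}.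
-- Passing cyclically from p to its successor keeps ⌊p/2⌋ if p is even and h(p)
-- if p is odd, so the offset of a cycle edge is that of the rung at one of its
-- two columns: always the second one if i is even, always the first if i is odd.

module Submission where

open import Defs
open import Data.Bool.Base using (Bool; true; false; not; if_then_else_)
open import Data.Bool.Properties using (not-¬; not-involutive; not-injective)
open import Data.Fin.Base as Fin using (Fin; toℕ; fromℕ<; inject₁)
open import Data.Fin.Properties
  using (toℕ-injective; toℕ<n; toℕ-fromℕ<; toℕ-inject₁; +↔⊎; *↔×)
open import Data.Nat.Base
  using (ℕ; zero; suc; _+_; _*_; _∸_; _≤_; _<_; z≤n; s≤s; z<s; s≤s⁻¹; ⌊_/2⌋; ∣_-_∣;
         NonZero; >-nonZero)
open import Data.Nat.DivMod
  using (_/_; _%_; m≡m%n+[m/n]*n; m%n<n; m/n*n≤m; [m+kn]%n≡m%n; m<n⇒m%n≡m)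
open import Data.Nat.Properties
open import Data.Nat.Tactic.RingSolver using (solve-∀)
open import Data.Product.Base using (∃-syntax; _×_; _,_; proj₁; proj₂)
open import Data.Product.Function.NonDependent.Propositional using (_×-↔_)
open import Data.Sum.Base using (_⊎_; inj₁; inj₂)
open import Function.Bundles using (Bijection; _↔_)
open import Function.Construct.Composition using (_↔-∘_; bijection)
open import Function.Construct.Identity using (↔-id)
open import Function.Properties.Inverse using (↔⇒⤖)
open import Relation.Binary.Bundles using (Setoid)
open import Relation.Binary.PropositionalEquality
  using (_≡_; _≢_; refl; sym; trans; cong; cong₂; subst; setoid; module ≡-Reasoning)
open import Relation.Nullary.Decidable.Core using (yes; no)
open import Relation.Nullary.Negation using (contradiction)
open import Relation.Unary using (_∖_)

-- Parity and halving of natural numbers.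

even : ℕ → Bool
even zero    = true
even (suc n) = not (even n)

even-+ : ∀ m n → even (m + n) ≡ (if even m then even n else not (even n))
even-+ zero    n = refl
even-+ (suc m) n rewrite even-+ m n with even m
... | true  = refl
... | false = not-involutive (even n)

even-double : ∀ n → even (n + n) ≡ true
even-double n rewrite even-+ n n with even n
... | true  = refl
... | false = refl

⌊suc/2⌋-even : ∀ n → even n ≡ true → ⌊ suc n /2⌋ ≡ ⌊ n /2⌋
⌊suc/2⌋-even zero          _ = refl
⌊suc/2⌋-even (suc (suc n)) e =
  cong suc (⌊suc/2⌋-even n (trans (sym (not-involutive (even n))) e))

⌊suc/2⌋-odd : ∀ n → even n ≡ false → ⌊ suc n /2⌋ ≡ suc ⌊ n /2⌋
⌊suc/2⌋-odd (suc zero)    _ = refl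
⌊suc/2⌋-odd (suc (suc n)) e =
  cong suc (⌊suc/2⌋-odd n (trans (sym (not-involutive (even n))) e))

⌊/2⌋-injective : ∀ m n → even m ≡ even n → ⌊ m /2⌋ ≡ ⌊ n /2⌋ → m ≡ n
⌊/2⌋-injective zero          zero          _ _ = refl
⌊/2⌋-injective zero          (suc zero)    () _
⌊/2⌋-injective (suc zero)    zero          () _
⌊/2⌋-injective (suc zero)    (suc zero)    _ _ = refl
⌊/2⌋-injective (suc (suc m)) (suc (suc n)) e h =
  cong (λ z → suc (suc z)) (⌊/2⌋-injective m n (not-injective (not-injective e)) (suc-injective h))

halve-suc : ∀ {a} n → suc (suc n) ≡ a + a → suc ⌊ n /2⌋ ≡ a
halve-suc {a} n e = trans (cong ⌊_/2⌋ e) (sym (n≡⌊n+n/2⌋ a))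

⌊/2⌋-< : ∀ {a n} → n < a + a → ⌊ n /2⌋ < a
⌊/2⌋-< {suc a} {zero}        _ = z<s
⌊/2⌋-< {suc a} {suc zero}    _ = z<s
⌊/2⌋-< {suc a} {suc (suc n)} (s≤s lt) rewrite +-suc a a with lt
... | s≤s lt′ = s≤s (⌊/2⌋-< lt′)

double-injective : ∀ {i j} → i + i ≡ j + j → i ≡ j
double-injective {i} {j} e = trans (n≡⌊n+n/2⌋ i) (trans (cong ⌊_/2⌋ e) (sym (n≡⌊n+n/2⌋ j)))

double-cancel-< : ∀ {i a} → i + i < a + a → i < a
double-cancel-< {i} h = subst (_< _) (sym (n≡⌊n+n/2⌋ i)) (⌊/2⌋-< h)

double≢suc-double : ∀ i j → i + i ≢ suc (j + j)
double≢suc-double i j e = contradiction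
  (trans (sym (even-double i)) (trans (cong even e) (cong not (even-double j)))) λ ()

halves : ∀ s → (∃[ i ] s ≡ i + i) ⊎ (∃[ i ] s ≡ suc (i + i))
halves zero    = inj₁ (0 , refl)
halves (suc s) with halves s
... | inj₁ (i , refl) = inj₂ (i , refl)
... | inj₂ (i , refl) = inj₁ (suc i , cong suc (sym (+-suc i i)))

-- Enumerating the naturals with one value omitted.

-- The increasing enumeration of ℕ ∖ {t}.
skip : ℕ → ℕ → ℕ
skip zero    j       = suc j
skip (suc t) zero    = zero
skip (suc t) (suc j) = suc (skip t j)

skip≢ : ∀ t j → skip t j ≢ t
skip≢ (suc t) (suc j) e = skip≢ t j (suc-injective e)

skip-injective : ∀ t {i j} → skip t i ≡ skip t j → i ≡ j
skip-injective zero    e = suc-injective e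
skip-injective (suc t) {zero}  {zero}  e = refl
skip-injective (suc t) {suc i} {suc j} e = cong suc (skip-injective t (suc-injective e))

skip≤ : ∀ t j → skip t j ≤ suc j
skip≤ zero    j       = ≤-refl
skip≤ (suc t) zero    = z≤n
skip≤ (suc t) (suc j) = s≤s (skip≤ t j)

skip-≥ : ∀ {t j} → t ≤ j → skip t j ≡ suc j
skip-≥ z≤n     = refl
skip-≥ (s≤s h) = cong suc (skip-≥ h)

-- The bound is on `suc j` because `skip t j` will be the value attached to column `suc j`, column 0
-- taking the omitted value.
skip-surjective : ∀ {t v N} → v ≢ t → t < N → v < N → ∃[ j ] suc j < N × skip t j ≡ v
skip-surjective {zero}  {zero}  v≢t _ _ = contradiction refl v≢t
skip-surjective {zero}  {suc v} _   _ v<N = v , v<N , refl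
skip-surjective {suc t} {zero}  _ (s≤s t<N) _ = zero , s≤s (≤-trans (s≤s z≤n) t<N) , refl
skip-surjective {suc t} {suc v} v≢t (s≤s t<N) (s≤s v<N)
  with j , j< , e ← skip-surjective (λ v≡t → v≢t (cong suc v≡t)) t<N v<N
  = suc j , s≤s j< , cong suc e

-- The two halves of `q` add up to `q`, and `skip k` adds one exactly when `⌊ q /2⌋` reaches `k`,
-- that is, when `q` reaches `k + k`. The induction lowers `k` by one and `q` by two.
skip-double : ∀ k q → ⌊ suc q /2⌋ + skip k ⌊ q /2⌋ ≡ skip (k + k) q
skip-double zero    q = trans (+-comm ⌊ suc q /2⌋ _) (cong suc (⌊n/2⌋+⌈n/2⌉≡n q))
skip-double (suc k) q rewrite +-suc k k with q
... | zero        = refl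
... | suc zero    = refl
... | suc (suc q) = cong suc (trans (+-suc _ _) (cong suc (skip-double k q)))

-- Base-`c` digits and truncated subtraction.

+*-injective : ∀ {a b s t c} → a < c → b < c → a + s * c ≡ b + t * c → a ≡ b × s ≡ t
+*-injective {a} {b} {s} {t} {c@(suc _)} a<c b<c e =
  a≡b , *-cancelʳ-≡ s t c (+-cancelˡ-≡ a _ _ (trans e (cong (_+ t * c) (sym a≡b))))
  where
  a≡b : a ≡ b
  a≡b = trans (sym (m<n⇒m%n≡m a<c)) (trans (sym ([m+kn]%n≡m%n a s c))
        (trans (cong (_% c) e) (trans ([m+kn]%n≡m%n b t c) (m<n⇒m%n≡m b<c))))

+*-< : ∀ {a s c d} → a < c → s < d → a + s * c < d * c
+*-< {a} {s} {c} {d} a<c s<d = ≤-trans (+-monoˡ-< (s * c) a<c) (*-monoˡ-≤ c s<d)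

-- Moving `a + b` to the left keeps the difference free of truncated subtraction, so later steps can
-- cancel additively.
∣-∸∣ : ∀ {a b D} → a + b ≤ D → ∣ a - D ∸ b ∣ + (a + b) ≡ D
∣-∸∣ {a} {b} {D} h = begin
  ∣ a - D ∸ b ∣ + (a + b)  ≡⟨ cong (_+ (a + b)) (m≤n⇒∣m-n∣≡n∸m (m+n≤o⇒m≤o∸n a h)) ⟩
  (D ∸ b) ∸ a + (a + b)    ≡⟨ cong₂ _+_ (trans (∸-+-assoc D b a) (cong (D ∸_) (+-comm b a))) refl ⟩
  D ∸ (a + b) + (a + b)    ≡⟨ m∸n+n≡m h ⟩
  D                        ∎
  where open ≡-Reasoning

module Labeling (k m′ : ℕ) (1≤k : 1 ≤ k) where

  n c m d : ℕ
  n = 4 * k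
  c = n + 1
  m = suc m′
  d = 2 * m ∸ 1

  Γ : Graph
  Γ = cycle n (3≤4* 1≤k) □ path m

  -- The bounds on `⌊_/2⌋` expect a number of the form `a + a`; here `a` is `k + k`, the value that
  -- the offsets omit.
  n≡ : n ≡ (k + k) + (k + k)
  n≡ = lemma k
    where
    lemma : ∀ k → 4 * k ≡ (k + k) + (k + k)
    lemma = solve-∀

  c≡ : c ≡ suc n
  c≡ = +-comm n 1

  d≡ : d ≡ suc (m′ + m′)
  d≡ = trans (+-suc m′ _) (cong (λ z → suc (m′ + z)) (+-identityʳ m′))

  -- Offsets of the rungs as a bijection on columns.

  highOffset : ℕ → ℕ
  highOffset zero    = k + k
  highOffset (suc q) = skip k ⌊ q /2⌋

  offset : ℕ → ℕ
  offset p = ⌊ p /2⌋ + highOffset p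

  offset-suc : ∀ q → offset (suc q) ≡ skip (k + k) q
  offset-suc = skip-double k

  offset-injective : ∀ p p′ → offset p ≡ offset p′ → p ≡ p′
  offset-injective zero    zero     e = refl
  offset-injective zero    (suc q′) e =
    contradiction (trans (sym (offset-suc q′)) (sym e)) (skip≢ (k + k) q′)
  offset-injective (suc q) zero     e =
    contradiction (trans (sym (offset-suc q)) e) (skip≢ (k + k) q)
  offset-injective (suc q) (suc q′) e =
    cong suc (skip-injective (k + k) (trans (sym (offset-suc q)) (trans e (offset-suc q′))))

  2k<n : k + k < n
  2k<n = subst (k + k <_) (sym n≡) (m<m+n (k + k) (≤-trans 1≤k (m≤m+n k k)))

  0<n : 0 < n
  0<n = ≤-trans (s≤s z≤n) 2k<n

  offset-surjective : ∀ {v} → v < n → ∃[ p ] p < n × offset p ≡ v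
  offset-surjective {v} v<n with v ≟ k + k
  -- Column 0 takes `k + k`, precisely the value that `skip (k + k)` misses.
  ... | yes refl = 0 , 0<n , refl
  ... | no v≢ with j , j< , e ← skip-surjective v≢ 2k<n v<n = suc j , j< , trans (offset-suc j) e

  -- The cyclic successor on columns.

  even-n : even n ≡ true
  even-n = trans (cong even n≡) (even-double (k + k))

  cyclic-even : ∀ {p p′} → CyclicSuc n p p′ → even (toℕ p′) ≡ not (even (toℕ p))
  cyclic-even (inj₁ e)       = cong even e
  cyclic-even (inj₂ (e , z)) = trans (cong even z) (sym (trans (cong even e) even-n))

  -- The wrap-around step leaves from column `n - 1`, which is odd since `n` is even; so an even
  -- column only has the ordinary successor.
  cyclic-⌊/2⌋ : ∀ {p p′} → CyclicSuc n p p′ → even (toℕ p) ≡ true → ⌊ toℕ p′ /2⌋ ≡ ⌊ toℕ p /2⌋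
  cyclic-⌊/2⌋ {p} (inj₁ e) ev = trans (cong ⌊_/2⌋ e) (⌊suc/2⌋-even (toℕ p) ev)
  cyclic-⌊/2⌋ {p} (inj₂ (e , _)) ev =
    contradiction (trans (cong not (sym ev)) (trans (cong even e) even-n)) λ ()

  -- For an ordinary step from `suc q` with `q` even, `q` and `suc q` have the same half. The
  -- wrap-around step leaves from the last column, where the omission of `k` has raised the value
  -- from `k + k - 1` to `k + k`, the value chosen for column 0.
  cyclic-highOffset : ∀ {p p′} → CyclicSuc n p p′ → even (toℕ p) ≡ false →
                      highOffset (toℕ p′) ≡ highOffset (toℕ p)
  cyclic-highOffset {p} step odd with toℕ p
  cyclic-highOffset (inj₁ e) odd | suc q =
    trans (cong highOffset e) (cong (skip k) (⌊suc/2⌋-even q (not-injective odd)))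
  cyclic-highOffset (inj₂ (e , z)) odd | suc q =
    trans (cong highOffset z) (sym (trans (skip-≥ k≤) half))
    where
    half : suc ⌊ q /2⌋ ≡ k + k
    half = halve-suc q (trans e n≡)

    k≤ : k ≤ ⌊ q /2⌋
    -- From `1 ≤ k` follows `suc k ≤ k + k`, and `k + k` is `suc ⌊ q /2⌋`.
    k≤ = s≤s⁻¹ (≤-trans (+-monoˡ-≤ k 1≤k) (≤-reflexive (sym half)))

  cyclic-total : ∀ p → ∃[ p′ ] CyclicSuc n p p′
  cyclic-total p with suc (toℕ p) <? n
  ... | yes lt = fromℕ< lt , inj₁ (toℕ-fromℕ< lt)
  ... | no ¬lt = fromℕ< 0<n , inj₂ (≤-antisym (toℕ<n p) (≮⇒≥ ¬lt) , toℕ-fromℕ< 0<n)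

  cyclic-functional : ∀ {p q q′} → CyclicSuc n p q → CyclicSuc n p q′ → q ≡ q′
  cyclic-functional (inj₁ e) (inj₁ e′) = toℕ-injective (trans e (sym e′))
  cyclic-functional {q = q} (inj₁ e) (inj₂ (e′ , _)) =
    contradiction (trans e e′) (<⇒≢ (toℕ<n q))
  cyclic-functional {q′ = q} (inj₂ (e , _)) (inj₁ e′) =
    contradiction (trans e′ e) (<⇒≢ (toℕ<n q))
  cyclic-functional (inj₂ (_ , z)) (inj₂ (_ , z′)) = toℕ-injective (trans z (sym z′))

  cyclic-injective : ∀ {p p′ q} → CyclicSuc n p q → CyclicSuc n p′ q → p ≡ p′
  cyclic-injective (inj₁ e)       (inj₁ e′)       = toℕ-injective (suc-injective (trans (sym e) e′))
  cyclic-injective (inj₁ e)       (inj₂ (_ , z))  = contradiction (trans (sym z) e) λ ()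
  cyclic-injective (inj₂ (_ , z)) (inj₁ e)        = contradiction (trans (sym z) e) λ ()
  cyclic-injective (inj₂ (e , _)) (inj₂ (e′ , _)) = toℕ-injective (suc-injective (trans e (sym e′)))

  cyclic-surjective : ∀ q → ∃[ p ] CyclicSuc n p q
  cyclic-surjective q with toℕ q in e
  ... | zero  = fromℕ< last<n , inj₂ (trans (cong suc (toℕ-fromℕ< last<n)) 1+last≡n , refl)
    where
    1+last≡n : suc (n ∸ 1) ≡ n
    1+last≡n = m+[n∸m]≡n 0<n

    last<n : n ∸ 1 < n
    last<n = ≤-reflexive 1+last≡n
  ... | suc r = fromℕ< r<n , inj₁ (cong suc (sym (toℕ-fromℕ< r<n)))
    where
    r<n : r < n
    r<n = <⇒≤ (subst (_< n) e (toℕ<n q))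

  -- The labels and their differences across an edge.

  column : V Γ → ℕ
  column (p , _) = toℕ p

  layer : V Γ → ℕ
  layer (_ , i) = toℕ i

  low : V Γ → Bool
  low x = even (column x + layer x)

  -- `highPart` is the distance of a high label below `d * c`. Its `suc` keeps high labels strictly
  -- under that bound and lets one truncated subtraction suffice.
  lowPart highPart : V Γ → ℕ
  lowPart  x = ⌊ column x /2⌋ + layer x * c
  highPart x = suc (highOffset (column x) + layer x * c)

  label : V Γ → ℕ
  label x = if low x then lowPart x else d * c ∸ highPart x

  column<2*2k : ∀ x → column x < (k + k) + (k + k)
  column<2*2k (p , _) = subst (toℕ p <_) n≡ (toℕ<n p)

  lowOffset< : ∀ x → ⌊ column x /2⌋ < k + k
  lowOffset< x = ⌊/2⌋-< (column<2*2k x)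

  highOffset≤ : ∀ {p} → p < (k + k) + (k + k) → highOffset p ≤ k + k
  highOffset≤ {zero}  _ = ≤-refl
  highOffset≤ {suc q} h = ≤-trans (skip≤ k _) (≤-trans (s≤s (⌊n/2⌋≤⌈n/2⌉ q)) (⌊/2⌋-< h))

  layers< : ∀ x y → layer x + layer y < d
  layers< (_ , i) (_ , j) =
    subst (toℕ i + toℕ j <_) (sym d≡) (s≤s (+-mono-≤ (s≤s⁻¹ (toℕ<n i)) (s≤s⁻¹ (toℕ<n j))))

  lowOffset+highOffset< : ∀ x y → ⌊ column x /2⌋ + highOffset (column y) < n
  lowOffset+highOffset< x y =
    <-≤-trans (+-mono-<-≤ (lowOffset< x) (highOffset≤ (column<2*2k y))) (≤-reflexive (sym n≡))

  lowPart+highPart : ∀ x y → lowPart x + highPart y ≡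
    suc (⌊ column x /2⌋ + highOffset (column y) + (layer x + layer y) * c)
  lowPart+highPart x y = lemma ⌊ column x /2⌋ (highOffset (column y)) (layer x) (layer y) c
    where
    lemma : ∀ a b i j c → a + i * c + suc (b + j * c) ≡ suc (a + b + (i + j) * c)
    lemma = solve-∀

  -- The digits fit: the combined offset is below `n`, the combined layer below `d`. As `x` and `y`
  -- need not be adjacent, this one bound gives the range of the labels, the separation of the sides
  -- and the exactness of every subtraction.
  lowPart+highPart< : ∀ x y → lowPart x + highPart y < d * c
  lowPart+highPart< x y = subst (_< d * c) (sym (lowPart+highPart x y))
    (+*-< (≤-trans (s≤s (lowOffset+highOffset< x y)) (≤-reflexive (sym c≡))) (layers< x y))

  highPart≤ : ∀ x → highPart x ≤ d * c
  highPart≤ x = ≤-trans (m≤n+m (highPart x) (lowPart x)) (<⇒≤ (lowPart+highPart< x x))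

  label-low : ∀ {x} → low x ≡ true → label x ≡ lowPart x
  label-low e rewrite e = refl

  label-high : ∀ {x} → low x ≡ false → label x ≡ d * c ∸ highPart x
  label-high e rewrite e = refl

  label-separated : ∀ {x y} → low x ≡ true → low y ≡ false → label x < label y
  label-separated {x} {y} lx ly rewrite label-low {x} lx | label-high {y} ly =
    m+n≤o⇒m≤o∸n (suc (lowPart x)) (lowPart+highPart< x y)

  gap-low-high : ∀ x y → low x ≡ true → low y ≡ false →
                 ∣ label x - label y ∣ +
                 suc (⌊ column x /2⌋ + highOffset (column y) + (layer x + layer y) * c) ≡ d * c
  gap-low-high x y lx ly
    rewrite sym (lowPart+highPart x y) | label-low {x} lx | label-high {y} ly =
    ∣-∸∣ {lowPart x} {highPart y} (<⇒≤ (lowPart+highPart< x y))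

  edgeOffset : V Γ → V Γ → ℕ
  edgeOffset x y = if low x
                   then ⌊ column x /2⌋ + highOffset (column y)
                   else highOffset (column x) + ⌊ column y /2⌋

  -- One end is low and the other high, so the absolute value reduces to `d * c` minus the sum of a
  -- `lowPart` and a `highPart`; symmetry covers the case where `y` is the low end.
  gap : ∀ x y → low y ≡ not (low x) →
        ∣ label x - label y ∣ + suc (edgeOffset x y + (layer x + layer y) * c) ≡ d * c
  -- Only the Boolean inside the offset is generalised; abstracting `low x` everywhere would also
  -- unfold the labels.
  gap x y ly = helper (low x) refl
    where
    helper : ∀ b → low x ≡ b →
             ∣ label x - label y ∣ + suc ((if b
                   then ⌊ column x /2⌋ + highOffset (column y)
                   else highOffset (column x) + ⌊ column y /2⌋) + (layer x + layer y) * c) ≡ d * c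
    helper true  lx = gap-low-high x y lx (trans ly (cong not lx))
    helper false lx
      rewrite ∣-∣-comm (label x) (label y)
            | +-comm (highOffset (column x)) ⌊ column y /2⌋
            | +-comm (layer x) (layer y)
            = gap-low-high y x (trans ly (cong not lx)) lx

  label-bounded : ∀ x → label x < d * c
  label-bounded x with low x
  ... | true  = ≤-trans (s≤s (m≤m+n (lowPart x) (highPart x))) (lowPart+highPart< x x)
  ... | false = ∸-monoʳ-< z<s (highPart≤ x)

  n<c : n < c
  n<c = ≤-reflexive (sym c≡)

  -- Injectivity of the labeling.

  even-column : ∀ {x y b} → low x ≡ b → low y ≡ b → layer x ≡ layer y →
                even (column x) ≡ even (column y)
  even-column {x} {y} lx ly i≡j = cancel (even (column x)) (even (column y)) (even (layer x))
    (trans (sym (even-+ (column x) (layer x))) (trans lx (trans (sym ly)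
      (trans (even-+ (column y) (layer y))
        (cong (λ i → if even (column y) then even i else not (even i)) (sym i≡j))))))
    where
    cancel : ∀ a b e → (if a then e else not e) ≡ (if b then e else not e) → a ≡ b
    cancel true  true  _ _ = refl
    cancel false false _ _ = refl
    cancel true  false e h = contradiction h (not-¬ refl)
    cancel false true  e h = contradiction (sym h) (not-¬ refl)

  -- The odd last column also has the value `k + k`; evenness is what leaves column 0 as the only
  -- one. For `q` odd, `suc ⌊ q /2⌋` is the half of `suc q`, hence below `k + k`.
  highOffset-suc< : ∀ {q} → suc q < (k + k) + (k + k) → even (suc q) ≡ true →
                    highOffset (suc q) < k + k
  highOffset-suc< {q} h ev = ≤-<-trans (skip≤ k _)
    (subst (_< k + k) (⌊suc/2⌋-odd q (not-injective ev)) (⌊/2⌋-< h))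

  highOffset-injective : ∀ p p′ → p < (k + k) + (k + k) → p′ < (k + k) + (k + k) →
                         even p ≡ even p′ → highOffset p ≡ highOffset p′ → p ≡ p′
  highOffset-injective zero    zero     _ _  _  _ = refl
  highOffset-injective zero    (suc q)  _ h  ev e = contradiction (sym e) (<⇒≢ (highOffset-suc< h (sym ev)))
  highOffset-injective (suc q) zero     h _  ev e = contradiction e (<⇒≢ (highOffset-suc< h ev))
  highOffset-injective (suc q) (suc q′) _ _  ev e =
    cong suc (⌊/2⌋-injective q q′ (not-injective ev) (skip-injective k e))

  offset<c : ∀ {a} → a ≤ k + k → a < c
  offset<c h = ≤-<-trans h (<-trans 2k<n n<c)

  vertex-≡ : ∀ {x y} → column x ≡ column y → layer x ≡ layer y → x ≡ y
  vertex-≡ p≡ i≡ = cong₂ _,_ (toℕ-injective p≡) (toℕ-injective i≡)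

  -- Both offsets are digits in base `c`, so the layers agree; with the side fixed, the columns then
  -- have equal parity, and the half determines the column.
  lowPart-injective : ∀ {x y} → low x ≡ true → low y ≡ true → lowPart x ≡ lowPart y → x ≡ y
  lowPart-injective {x} {y} lx ly e
    with a≡ , i≡ ← +*-injective {s = layer x} {layer y}
                     (offset<c (<⇒≤ (lowOffset< x))) (offset<c (<⇒≤ (lowOffset< y))) e
    = vertex-≡ (⌊/2⌋-injective _ _ (even-column {x} {y} lx ly i≡) a≡) i≡

  highPart-injective : ∀ {x y} → low x ≡ false → low y ≡ false → highPart x ≡ highPart y → x ≡ y
  highPart-injective {x} {y} lx ly e
    with a≡ , i≡ ← +*-injective {s = layer x} {layer y}
                     (offset<c (highOffset≤ (column<2*2k x))) (offset<c (highOffset≤ (column<2*2k y)))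
                     (suc-injective e)
    = vertex-≡ (highOffset-injective _ _ (column<2*2k x) (column<2*2k y)
                  (even-column {x} {y} lx ly i≡) a≡) i≡

  label-injective : ∀ {x y} → label x ≡ label y → x ≡ y
  label-injective {x} {y} e = helper (low x) (low y) refl refl
    where
    helper : ∀ a b → low x ≡ a → low y ≡ b → x ≡ y
    helper true  true  lx ly = lowPart-injective lx ly
      (trans (sym (label-low {x} lx)) (trans e (label-low {y} ly)))
    helper true  false lx ly = contradiction e (<⇒≢ (label-separated {x} {y} lx ly))
    helper false true  lx ly = contradiction (sym e) (<⇒≢ (label-separated {y} {x} ly lx))
    helper false false lx ly = highPart-injective lx ly
      (∸-cancelˡ-≡ (highPart≤ x) (highPart≤ y)
        (trans (sym (label-high {x} lx)) (trans e (label-high {y} ly))))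

  -- The bipartition.

  low-cyclic : ∀ {p p′} (i : Fin m) → CyclicSuc n p p′ → low (p′ , i) ≡ not (low (p , i))
  low-cyclic {p} {p′} i step
    rewrite even-+ (toℕ p′) (toℕ i) | even-+ (toℕ p) (toℕ i) | cyclic-even {p} {p′} step
    with even (toℕ p)
  ... | true  = refl
  ... | false = sym (not-involutive _)

  low-vertical : ∀ (p : Fin n) {i j : Fin m} → toℕ j ≡ suc (toℕ i) → low (p , j) ≡ not (low (p , i))
  low-vertical p {i} e = cong even (trans (cong (toℕ p +_) e) (+-suc (toℕ p) (toℕ i)))

  not-swap : ∀ {a b} → a ≡ not b → b ≡ not a
  not-swap e = trans (sym (not-involutive _)) (cong not (sym e))

  low-flip : ∀ {x y} → Adj Γ x y → low y ≡ not (low x)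
  low-flip {_ , i} (inj₁ (inj₁ s , refl)) = low-cyclic i s
  low-flip {_ , i} (inj₁ (inj₂ s , refl)) = not-swap (low-cyclic i s)
  low-flip {p , _} (inj₂ (refl , inj₁ e)) = low-vertical p e
  low-flip {p , _} (inj₂ (refl , inj₂ e)) = not-swap (low-vertical p e)

  low-proper : ∀ {x y} → Adj Γ x y → low x ≢ low y
  low-proper a e = not-¬ e (not-swap (low-flip a))

  -- Enumeration of the edges and their codes.

  -- The left summand indexes the `m` cycles, the right one the `m′` gaps between consecutive
  -- layers. Each of these blocks holds `n` edges.
  Layers : Set
  Layers = Fin m ⊎ Fin m′

  EdgeIndex : Set
  EdgeIndex = Layers × Fin n

  next : Fin n → Fin n
  next p = proj₁ (cyclic-total p)

  next-cyclic : ∀ p → CyclicSuc n p (next p)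
  next-cyclic p = proj₂ (cyclic-total p)

  next-⌊/2⌋ : ∀ p → even (toℕ p) ≡ true → ⌊ toℕ (next p) /2⌋ ≡ ⌊ toℕ p /2⌋
  next-⌊/2⌋ p = cyclic-⌊/2⌋ {p} {next p} (next-cyclic p)

  next-highOffset : ∀ p → even (toℕ p) ≡ false → highOffset (toℕ (next p)) ≡ highOffset (toℕ p)
  next-highOffset p = cyclic-highOffset {p} {next p} (next-cyclic p)

  source target : EdgeIndex → V Γ
  source (inj₁ i , p) = p , i
  source (inj₂ i , p) = p , inject₁ i
  target (inj₁ i , p) = next p , i
  target (inj₂ i , p) = p , Fin.suc i

  source-target : ∀ ι → Adj Γ (source ι) (target ι)
  source-target (inj₁ i , p) = inj₁ (inj₁ (next-cyclic p) , refl)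
  source-target (inj₂ i , p) = inj₂ (refl , inj₁ (cong suc (sym (toℕ-inject₁ i))))

  rank : Layers → ℕ
  rank (inj₁ i) = toℕ i + toℕ i
  rank (inj₂ i) = suc (toℕ i + toℕ i)

  -- The column of the rung that has the same offset as the given edge.
  pivot : EdgeIndex → Fin n
  pivot (inj₁ i , p) = if even (toℕ i) then next p else p
  pivot (inj₂ i , p) = p

  layers-rank : ∀ ι → layer (source ι) + layer (target ι) ≡ rank (proj₁ ι)
  layers-rank (inj₁ i , p) = refl
  layers-rank (inj₂ i , p) rewrite toℕ-inject₁ i = +-suc (toℕ i) (toℕ i)

  -- On a cycle, the parity of `p` decides which of the two summands is shared by both columns, and
  -- together with the parity of `i` it decides which end is low. In all four cases the sum belongs
  -- to `next p` if `i` is even and to `p` if `i` is odd.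
  edgeOffset-offset : ∀ ι → edgeOffset (source ι) (target ι) ≡ offset (toℕ (pivot ι))
  edgeOffset-offset (inj₂ i , p) with low (p , inject₁ i)
  ... | true  = refl
  ... | false = +-comm (highOffset (toℕ p)) _
  edgeOffset-offset (inj₁ i , p)
    rewrite even-+ (toℕ p) (toℕ i) with even (toℕ p) in ep | even (toℕ i)
  ... | true  | true  = cong (_+ highOffset (toℕ (next p))) (sym (next-⌊/2⌋ p ep))
  ... | true  | false = trans (cong (highOffset (toℕ p) +_) (next-⌊/2⌋ p ep))
                              (+-comm (highOffset (toℕ p)) _)
  ... | false | true  = trans (cong (_+ ⌊ toℕ (next p) /2⌋) (sym (next-highOffset p ep)))
                              (+-comm (highOffset (toℕ (next p))) _)
  ... | false | false = cong (⌊ toℕ p /2⌋ +_) (next-highOffset p ep)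

  difference : EdgeIndex → ℕ
  difference ι = ∣ label (source ι) - label (target ι) ∣

  -- A two-digit numeral in base `c` whose lower digit is below `n`, hence never the top digit
  -- `c - 1`; this gap produces the excluded multiples of `c`.
  code : EdgeIndex → ℕ
  code (l , p) = offset (toℕ (pivot (l , p))) + rank l * c

  difference+code : ∀ ι → difference ι + suc (code ι) ≡ d * c
  difference+code ι = trans
    (cong₂ (λ a s → difference ι + suc (a + s * c)) (sym (edgeOffset-offset ι)) (sym (layers-rank ι)))
    (gap (source ι) (target ι) (low-flip (source-target ι)))

  -- Parity tells cycles from rungs, and halving recovers the index.
  rank-injective : ∀ {l l′} → rank l ≡ rank l′ → l ≡ l′
  rank-injective {inj₁ i} {inj₁ j} e = cong inj₁ (toℕ-injective (double-injective e))
  rank-injective {inj₁ i} {inj₂ j} e = contradiction e (double≢suc-double (toℕ i) (toℕ j))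
  rank-injective {inj₂ i} {inj₁ j} e = contradiction (sym e) (double≢suc-double (toℕ j) (toℕ i))
  rank-injective {inj₂ i} {inj₂ j} e = cong inj₂ (toℕ-injective (double-injective (suc-injective e)))

  rank-surjective : ∀ {s} → s < d → ∃[ l ] rank l ≡ s
  rank-surjective {s} s<d with halves s
  ... | inj₁ (i , refl) = inj₁ (fromℕ< i<) , cong₂ _+_ (toℕ-fromℕ< i<) (toℕ-fromℕ< i<)
    where
    i< : i < m
    i< = double-cancel-< (≤-trans s<d (≤-trans (≤-reflexive d≡) (s≤s (+-monoʳ-≤ m′ (n≤1+n m′)))))
  ... | inj₂ (i , refl) = inj₂ (fromℕ< i<) , cong suc (cong₂ _+_ (toℕ-fromℕ< i<) (toℕ-fromℕ< i<))
    where
    i< : i < m′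
    i< = double-cancel-< (s≤s⁻¹ (≤-trans s<d (≤-reflexive d≡)))

  pivot-injective : ∀ l {p p′} → pivot (l , p) ≡ pivot (l , p′) → p ≡ p′
  pivot-injective (inj₁ i) {p} {p′} e with even (toℕ i)
  ... | true  = cyclic-injective (next-cyclic p) (subst (CyclicSuc n p′) (sym e) (next-cyclic p′))
  ... | false = e
  pivot-injective (inj₂ i) e = e

  pivot-surjective : ∀ l q → ∃[ p ] pivot (l , p) ≡ q
  pivot-surjective (inj₁ i) q with even (toℕ i)
  ... | true  = let p , s = cyclic-surjective q in p , cyclic-functional {p} (next-cyclic p) s
  ... | false = q , refl
  pivot-surjective (inj₂ i) q = q , refl

  offset< : ∀ (p : Fin n) → offset (toℕ p) < n
  offset< p = lowOffset+highOffset< (p , Fin.zero) (p , Fin.zero)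

  code-injective : ∀ {ι κ} → code ι ≡ code κ → ι ≡ κ
  code-injective {l , p} {l′ , p′} e
    with a≡ , s≡ ← +*-injective {s = rank l} {rank l′}
           (<-trans (offset< (pivot (l , p))) n<c)
           (<-trans (offset< (pivot (l′ , p′))) n<c) e
    with refl ← rank-injective {l} {l′} s≡
    = cong (l ,_) (pivot-injective l (toℕ-injective (offset-injective _ _ a≡)))

  code-surjective : ∀ {a s} → a < n → s < d → ∃[ ι ] code ι ≡ a + s * c
  code-surjective a<n s<d
    with l , refl ← rank-surjective s<d
    with p , p<n , refl ← offset-surjective a<n
    with q , e ← pivot-surjective l (fromℕ< p<n)
    = (l , q) , cong (λ z → offset z + rank l * c) (trans (cong toℕ e) (toℕ-fromℕ< p<n))

  -- The number of edges.

  -- This also shows that the enumeration of edges has no repetitions: an unordered edge determines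
  -- its difference, so two indices of the same edge have equal differences.
  difference-injective : ∀ {ι κ} → difference ι ≡ difference κ → ι ≡ κ
  difference-injective {ι} {κ} e = code-injective (suc-injective (+-cancelˡ-≡ (difference ι) _ _
    (trans (difference+code ι) (trans (sym (difference+code κ)) (cong (_+ suc (code κ)) (sym e))))))

  edge : EdgeIndex → Setoid.Carrier (edges Γ)
  edge ι = (source ι , target ι) , source-target ι

  ∼-difference : ∀ {x y x′ y′} → (x , y) ∼ (x′ , y′) → ∣ label x - label y ∣ ≡ ∣ label x′ - label y′ ∣
  ∼-difference         same = refl
  ∼-difference {x} {y} flip = ∣-∣-comm (label x) (label y)

  cyclic-edge : ∀ {p p′} i → CyclicSuc n p p′ →
                (source (inj₁ i , p) , target (inj₁ i , p)) ∼ ((p , i) , (p′ , i))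
  cyclic-edge {p} i s with refl ← cyclic-functional {p} (next-cyclic p) s = same

  vertical-edge : ∀ p {i j} → toℕ j ≡ suc (toℕ i) → ∃[ ι ] (source ι , target ι) ∼ ((p , i) , (p , j))
  vertical-edge p {i} {Fin.suc j} e
    with refl ← toℕ-injective {i = i} {inject₁ j}
                  (trans (sym (suc-injective e)) (sym (toℕ-inject₁ j)))
    = (inj₂ j , p) , same

  edge-surjective : ∀ {x y} → Adj Γ x y → ∃[ ι ] (source ι , target ι) ∼ (x , y)
  edge-surjective {p , i}          (inj₁ (inj₁ s , refl)) = (inj₁ i , p) , cyclic-edge i s
  edge-surjective {_}     {q , i}  (inj₁ (inj₂ s , refl)) = (inj₁ i , q) , ∼-trans (cyclic-edge i s) flip
  edge-surjective {p , _}          (inj₂ (refl , inj₁ e)) = vertical-edge p e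
  edge-surjective {p , _}          (inj₂ (refl , inj₂ e)) =
    let ι , s = vertical-edge p e in ι , ∼-trans s flip

  index↔ : Fin (d * n) ↔ EdgeIndex
  -- Once `d` is rewritten to `suc (m′ + m′)`, it is `m + m′` by computation, which `+↔⊎` splits.
  index↔ = subst (λ z → Fin (z * n) ↔ EdgeIndex) (sym d≡) ((+↔⊎ ×-↔ ↔-id (Fin n)) ↔-∘ *↔×)

  edge-bijection : Bijection (setoid EdgeIndex) (edges Γ)
  edge-bijection = record
    { to        = edge
    ; cong      = λ { refl → same }
    ; bijective = (λ {ι} {κ} s → difference-injective {ι} {κ} (∼-difference s))
                , λ (_ , a) → let ι , s = edge-surjective a in ι , λ { refl → s }
    }

  size : HasSize Γ (d * n)
  size = bijection (↔⇒⤖ index↔) edge-bijection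

  -- The set of differences.

  -- Otherwise `d * c` would have the remainder `suc a` modulo `c`, which lies strictly between 0
  -- and `c`. Leaving `j` arbitrary makes `j = 0` available, which gives positivity of the
  -- difference.
  difference≢multiple : ∀ ι j → difference ι ≢ j * c
  difference≢multiple ι@(l , p) j e =
    contradiction (proj₁ (+*-injective {s = j + rank l} {d} 1+a<c 0<c sum)) λ ()
    where
    a : ℕ
    a = offset (toℕ (pivot ι))

    1+a<c : suc a < c
    1+a<c = ≤-trans (s≤s (offset< (pivot ι))) n<c

    0<c : 0 < c
    0<c = ≤-trans (s≤s z≤n) 1+a<c

    lemma : ∀ a j s c → suc a + (j + s) * c ≡ j * c + suc (a + s * c)
    lemma = solve-∀

    sum : suc a + (j + rank l) * c ≡ 0 + d * c
    sum = trans (lemma a j (rank l) c) (trans (cong (_+ suc (code ι)) (sym e)) (difference+code ι))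

  difference-admissible : ∀ ι → ([1⋯ d * c ] ∖ multiples d c) (difference ι)
  difference-admissible ι =
    (n≢0⇒n>0 (difference≢multiple ι 0) , ≤-trans (m≤m+n _ _) (≤-reflexive (difference+code ι)))
    , λ (j , _ , e) → difference≢multiple ι j e

  differences⊆ : ∀ {t} → differences Γ label t → ([1⋯ d * c ] ∖ multiples d c) t
  differences⊆ (x , y , a , refl) with ι , s ← edge-surjective a =
    subst ([1⋯ d * c ] ∖ multiples d c) (∼-difference s) (difference-admissible ι)

  differences⊇ : ∀ {t} → ([1⋯ d * c ] ∖ multiples d c) t → differences Γ label t
  differences⊇ {t} ((1≤t , t≤) , ¬multiple) =
    helper (w % c) (m%n<n w c) (m≡m%n+[m/n]*n w c)
    where
    instance
      c≢0 : NonZero c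
      c≢0 = >-nonZero (≤-trans (s≤s z≤n) n<c)

    w s : ℕ
    w = d * c ∸ t
    s = w / c

    t+w : t + w ≡ d * c
    t+w = m+[n∸m]≡n t≤

    s<d : s < d
    -- Since `t` is positive, `w` is strictly below `d * c`, and so is `s * c`.
    s<d = *-cancelʳ-< c s d (≤-<-trans (m/n*n≤m w c) (subst (w <_) t+w (m<n+m w 1≤t)))

    helper : ∀ r → r < c → w ≡ r + s * c → differences Γ label t
    -- Remainder 0 would make `t` the excluded multiple with factor `d ∸ s`, which lies between 1
    -- and `d`.
    helper zero    _   e = contradiction (d ∸ s , (m<n⇒0<n∸m s<d , m∸n≤m d s) , multiple) ¬multiple
      where
      multiple : t ≡ (d ∸ s) * c
      multiple = trans (sym (m∸[m∸n]≡n t≤)) (trans (cong (d * c ∸_) e) (sym (*-distribʳ-∸ c d s)))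
    -- The code sought is `w - 1`, with digits `a` and `s`; `suc a < c` gives `a < n` because `c` is
    -- `suc n`.
    helper (suc a) r<c e
      with ι , h ← code-surjective {a} (s≤s⁻¹ (≤-trans r<c (≤-reflexive c≡))) s<d =
      source ι , target ι , source-target ι ,
      +-cancelʳ-≡ w t (difference ι) (trans t+w (trans (sym (difference+code ι))
        (cong (difference ι +_) (trans (cong suc h) (sym e)))))

theorem3p1 : ∀ (k m : ℕ) → (1≤k : 1 ≤ k) → 2 ≤ m → DivisibleGracefulAlphaLabeling (2 * m ∸ 1) (cycle (4 * k) (3≤4* 1≤k) □ path m)
theorem3p1 k (suc m′) 1≤k _ = record
  { labeling    = record
    { q         = n
    ; d>0       = ≤-trans (s≤s z≤n) (≤-reflexive (sym d≡))
    ; q>0       = 0<n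
    ; size      = size
    ; f         = label
    ; bounded   = label-bounded
    ; injective = label-injective
    ; graceful  = differences⊆ , differences⊇
    }
  ; bipartition = record { side = low ; proper = low-proper }
  ; low         = true
  ; separated   = λ {x} {y} → label-separated {x} {y}
  }
  where open Labeling k m′ 1≤k
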